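{- For every constant $c$ there is a polynomial-time algorithm that, given any finite graph $G$ of diameter at most $c$, outputs an optimal burning schedule of $G$, i.e. a burning schedule that burns all vertices of $G$ in $bn(G)$ rounds.
   Context: Graphs are finite, simple, undirected and unweighted; $d(u,v)$ denotes the shortest-path distance, and the diameter is the maximum distance between two vertices (so a graph of finite diameter is connected). Burning process: it takes place in synchronous rounds $1,2,\dots$. In each round $i$, every vertex having a neighbour that was burned in an earlier round becomes burned, and additionally one chosen vertex $a_i$ (the activator of round $i$) becomes burned; burned vertices stay burned. A burning schedule $\langle a_1,\dots,a_m\rangle$ burns $G$ in $m$ rounds if all vertices are burned by the end of round $m$, equivalently every vertex $v$ satisfies $d(v,a_i)\le m-i$ for some $i\in\{1,\dots,m\}$. The burning number $bn(G)$ is the minimum $m$ for which a burning schedule burning $G$ in $m$ rounds exists. -}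

module Defs where

open import Data.Bool using (Bool; true; false)
open import Data.Fin using (Fin; zero; suc; toℕ)
open import Data.List as List using (List; []; _∷_; foldr)
open import Data.Nat using (ℕ; zero; suc; _+_; _*_; _≤_)
open import Data.Product using (∃-syntax; _×_; _,_)
open import Data.Vec as Vec using (Vec; lookup; toList)
open import Relation.Binary.PropositionalEquality using (_≡_)

record Graph : Set where
  field
    order  : ℕ
    adj    : Fin order → Fin order → Bool
    symm   : ∀ u v → adj u v ≡ adj v u
    irrefl : ∀ u → adj u u ≡ false

open Graph public

Vertex : Graph → Set
Vertex G = Fin (order G)

Adjacent : (G : Graph) → Vertex G → Vertex G → Set
Adjacent G u v = adj G u v ≡ true

data Walk (G : Graph) : Vertex G → Vertex G → ℕ → Set where
  stop : ∀ {u} → Walk G u u 0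
  step : ∀ {u v w k} → Adjacent G u v → Walk G v w k → Walk G u w (suc k)

IsDistance : (G : Graph) → Vertex G → Vertex G → ℕ → Set
IsDistance G u v d = Walk G u v d × (∀ k → Walk G u v k → d ≤ k)

-- A graph with a diameter in this sense is connected and has a vertex.
IsDiameter : Graph → ℕ → Set
IsDiameter G D =
    (∀ u v → ∃[ d ] IsDistance G u v d × d ≤ D)
  × (∃[ u ] ∃[ v ] IsDistance G u v D)

DiameterAtMost : ℕ → Graph → Set
DiameterAtMost c G = ∃[ D ] IsDiameter G D × D ≤ c

Schedule : Graph → ℕ → Set
Schedule G m = Vec (Vertex G) m

-- `Burned G s i v`: under schedule s, v is burned by the end of round i.
-- Rounds are numbered from 1, so the activator of round i + 1 is the entry of
-- s at index i; nothing is burned at the end of "round 0".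
data Burned (G : Graph) {m : ℕ} (s : Schedule G m) : ℕ → Vertex G → Set where
  activate : (i : Fin m) → Burned G s (suc (toℕ i)) (lookup s i)
  spread   : ∀ {i u v} → Adjacent G u v → Burned G s i u → Burned G s (suc i) v
  stay     : ∀ {i v} → Burned G s i v → Burned G s (suc i) v

Burns : (G : Graph) {m : ℕ} → Schedule G m → Set
Burns G {m} s = ∀ v → Burned G s m v

IsBurningNumber : Graph → ℕ → Set
IsBurningNumber G m =
    (∃[ s ] Burns G {m} s)
  × (∀ {m′} (s : Schedule G m′) → Burns G s → m ≤ m′)

-- The machine model is first-order LISP: call-by-value, mutually recursive
-- functions of one argument, whose data are binary trees (compare the
-- languages F and WHILE of N. D. Jones, "Computability and Complexity from a
-- Programming Perspective").  Every evaluation step costs one unit.  With trees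
-- shared in a heap, a step takes a bounded number of pointer operations and
-- allocates at most one node, so polynomial time here agrees with polynomial
-- time on a Turing machine whenever, as below, outputs have polynomial size.

infixr 5 _∙_

data Tree : Set where
  nil : Tree
  _∙_ : Tree → Tree → Tree

size : Tree → ℕ
size nil     = 1
size (a ∙ b) = suc (size a + size b)

head tail : Tree → Tree
head nil     = nil
head (a ∙ b) = a
tail nil     = nil
tail (a ∙ b) = b

-- Expressions over k function symbols; `arg` is the argument of the function
-- being defined, and `if` takes its else-branch exactly on nil.
data Exp (k : ℕ) : Set where
  arg nil       : Exp k
  cons          : Exp k → Exp k → Exp k
  hd tl         : Exp k → Exp k
  if_then_else_ : Exp k → Exp k → Exp k → Exp k
  call          : Fin k → Exp k → Exp k

-- `Eval fs x e v t`: with function bodies fs and argument x, e evaluates to v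
-- in time t.
data Eval {k : ℕ} (fs : Vec (Exp k) k) (x : Tree) : Exp k → Tree → ℕ → Set where
  arg     : Eval fs x arg x 1
  nil     : Eval fs x nil nil 1
  cons    : ∀ {e₁ e₂ v₁ v₂ t₁ t₂} →
            Eval fs x e₁ v₁ t₁ → Eval fs x e₂ v₂ t₂ →
            Eval fs x (cons e₁ e₂) (v₁ ∙ v₂) (suc (t₁ + t₂))
  hd      : ∀ {e v t} → Eval fs x e v t → Eval fs x (hd e) (head v) (suc t)
  tl      : ∀ {e v t} → Eval fs x e v t → Eval fs x (tl e) (tail v) (suc t)
  if-then : ∀ {e₁ e₂ e₃ a b v t₁ t₂} →
            Eval fs x e₁ (a ∙ b) t₁ → Eval fs x e₂ v t₂ →
            Eval fs x (if e₁ then e₂ else e₃) v (suc (t₁ + t₂))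
  if-else : ∀ {e₁ e₂ e₃ v t₁ t₂} →
            Eval fs x e₁ nil t₁ → Eval fs x e₃ v t₂ →
            Eval fs x (if e₁ then e₂ else e₃) v (suc (t₁ + t₂))
  call    : ∀ {f e y v t₁ t₂} →
            Eval fs x e y t₁ → Eval fs y (lookup fs f) v t₂ →
            Eval fs x (call f e) v (suc (t₁ + t₂))

-- Function zero is the entry point.
record Program : Set where
  field
    {extra} : ℕ
    bodies  : Vec (Exp (suc extra)) (suc extra)

open Program public

Runs : Program → Tree → Tree → ℕ → Set
Runs P x v t = Eval (bodies P) x (lookup (bodies P) zero) v t

-- Coefficients, constant term first.
Polynomial : Set
Polynomial = List ℕ

evalPoly : Polynomial → ℕ → ℕ
evalPoly p x = foldr (λ a r → a + x * r) 0 p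

encodeList : {A : Set} → (A → Tree) → List A → Tree
encodeList enc = foldr (λ a r → enc a ∙ r) nil

encodeBool : Bool → Tree
encodeBool false = nil
encodeBool true  = nil ∙ nil

encodeℕ : ℕ → Tree
encodeℕ zero    = nil
encodeℕ (suc n) = nil ∙ encodeℕ n

-- The adjacency matrix, as a list of rows.
encodeGraph : Graph → Tree
encodeGraph G =
  encodeList (encodeList encodeBool)
    (List.tabulate (λ u → List.tabulate (adj G u)))

encodeSchedule : (G : Graph) {m : ℕ} → Schedule G m → Tree
encodeSchedule G s = encodeList (λ v → encodeℕ (toℕ v)) (toList s)

{-# OPTIONS --safe #-}
module Submission where

-- If G has diameter at most c, then any vertex, activated in round 1, burns G
-- within 1 + c rounds.  So a brute-force search over all schedules of length
-- m = 0, 1, …, 1 + c succeeds, its first success is optimal, and for fixed c it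
-- inspects only polynomially many schedules.  The search simulates the process
-- on the set of burned vertices, stored as a list of bits.

open import Data.Bool using (Bool; true; false; T; _∧_; _∨_)
open import Data.Bool.Properties using (T?; T-≡; T-∧; T-∨)
open import Data.Fin as Fin using (Fin; zero; suc; toℕ; #_)
open import Data.Fin.Properties using (any?; toℕ-injective; ∀-cons)
open import Data.List as List using (List; []; _∷_)
open import Data.List.Properties using (length-tabulate)
open import Data.Nat using (ℕ; zero; suc; _+_; _*_; _∸_; _≤_; z≤n; s≤s)
open import Data.Nat.Properties
open import Data.Nat.Tactic.RingSolver using (solve-∀)
open import Data.Product using (Σ-syntax; ∃-syntax; _×_; _,_; proj₁)
open import Data.Sum using (_⊎_; inj₁; inj₂; [_,_])
open import Data.Vec as Vec using (Vec; []; _∷_; lookup)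
open import Data.Vec.Functional using (updateAt)
open import Data.Vec.Functional.Properties using (updateAt-updates; updateAt-minimal)
open import Function using (_∘_; id; _⇔_; mk⇔; module Equivalence)
open import Relation.Binary.PropositionalEquality
  using (_≡_; refl; sym; trans; cong; cong₂; subst; module ≡-Reasoning)
open import Relation.Nullary using (Dec; yes; no; does; contradiction)
import Relation.Nullary.Decidable as Dec
open import Defs

open Equivalence using (to; from)

-- Polynomially bounded functions

IsPolynomial : (ℕ → ℕ) → Set
IsPolynomial f = Σ[ p ∈ Polynomial ] (∀ x → f x ≡ evalPoly p x)

_⊕_ : Polynomial → Polynomial → Polynomial
[]      ⊕ q       = q
(a ∷ p) ⊕ []      = a ∷ p
(a ∷ p) ⊕ (b ∷ q) = (a + b) ∷ (p ⊕ q)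

_⊗_ : Polynomial → Polynomial → Polynomial
[]      ⊗ q = []
(a ∷ p) ⊗ q = List.map (a *_) q ⊕ (0 ∷ (p ⊗ q))

evalPoly-⊕ : ∀ p q x → evalPoly p x + evalPoly q x ≡ evalPoly (p ⊕ q) x
evalPoly-⊕ []      q       x = refl
evalPoly-⊕ (a ∷ p) []      x = +-identityʳ _
evalPoly-⊕ (a ∷ p) (b ∷ q) x =
  trans (rearrange a b x (evalPoly p x) (evalPoly q x))
        (cong (λ r → a + b + x * r) (evalPoly-⊕ p q x))
  where
  rearrange : ∀ a b x r s → (a + x * r) + (b + x * s) ≡ a + b + x * (r + s)
  rearrange = solve-∀

evalPoly-map : ∀ a q x → a * evalPoly q x ≡ evalPoly (List.map (a *_) q) x
evalPoly-map a []      x = *-zeroʳ a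
evalPoly-map a (b ∷ q) x =
  trans (rearrange a b x (evalPoly q x))
        (cong (λ r → a * b + x * r) (evalPoly-map a q x))
  where
  rearrange : ∀ a b x r → a * (b + x * r) ≡ a * b + x * (a * r)
  rearrange = solve-∀

evalPoly-⊗ : ∀ p q x → evalPoly p x * evalPoly q x ≡ evalPoly (p ⊗ q) x
evalPoly-⊗ []      q x = refl
evalPoly-⊗ (a ∷ p) q x = begin
  (a + x * evalPoly p x) * evalPoly q x
    ≡⟨ rearrange a x (evalPoly p x) (evalPoly q x) ⟩
  a * evalPoly q x + x * (evalPoly p x * evalPoly q x)
    ≡⟨ cong₂ (λ r s → r + x * s) (evalPoly-map a q x) (evalPoly-⊗ p q x) ⟩
  evalPoly (List.map (a *_) q) x + evalPoly (0 ∷ (p ⊗ q)) x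
    ≡⟨ evalPoly-⊕ (List.map (a *_) q) (0 ∷ (p ⊗ q)) x ⟩
  evalPoly ((a ∷ p) ⊗ q) x ∎
  where
  open ≡-Reasoning
  rearrange : ∀ a x r s → (a + x * r) * s ≡ a * s + x * (r * s)
  rearrange = solve-∀

evalPoly-mono : ∀ p {x y} → x ≤ y → evalPoly p x ≤ evalPoly p y
evalPoly-mono []      x≤y = z≤n
evalPoly-mono (a ∷ p) x≤y = +-monoʳ-≤ a (*-mono-≤ x≤y (evalPoly-mono p x≤y))

≤-evalPoly : ∀ {f t x y} (fᵖ : IsPolynomial f) →
  t ≤ f x → x ≤ y → t ≤ evalPoly (proj₁ fᵖ) y
≤-evalPoly (p , f≡p) t≤fx x≤y =
  ≤-trans t≤fx (≤-trans (≤-reflexive (f≡p _)) (evalPoly-mono p x≤y))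

constᵖ : ∀ a → IsPolynomial (λ _ → a)
constᵖ a = a ∷ [] , λ x → sym (trans (cong (a +_) (*-zeroʳ x)) (+-identityʳ a))

idᵖ : IsPolynomial (λ x → x)
idᵖ = 0 ∷ 1 ∷ [] , λ x →
  sym (trans (cong (λ r → x * (1 + r)) (*-zeroʳ x)) (*-identityʳ x))

_+ᵖ_ : ∀ {f g} → IsPolynomial f → IsPolynomial g → IsPolynomial (λ x → f x + g x)
(p , f≡p) +ᵖ (q , g≡q) =
  p ⊕ q , λ x → trans (cong₂ _+_ (f≡p x) (g≡q x)) (evalPoly-⊕ p q x)

_*ᵖ_ : ∀ {f g} → IsPolynomial f → IsPolynomial g → IsPolynomial (λ x → f x * g x)
(p , f≡p) *ᵖ (q , g≡q) =
  p ⊗ q , λ x → trans (cong₂ _*_ (f≡p x) (g≡q x)) (evalPoly-⊗ p q x)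

infixl 6 _+ᵖ_
infixl 7 _*ᵖ_

-- The process on sets of vertices

BitSet : ℕ → Set
BitSet n = Fin n → Bool

T-does : ∀ {P : Set} (d : Dec P) → T (does d) ⇔ P
T-does (yes p) = mk⇔ (λ _ → p) (λ _ → _)
T-does (no ¬p) = mk⇔ (λ ()) ¬p

-- `does` of `any?` unfolds definitionally to a disjunction over the positions, which is the
-- recursion of `meetsᵉ`.
meets : ∀ {n} → BitSet n → BitSet n → Bool
meets B r = does (any? (λ u → T? (B u ∧ r u)))

-- `C` and `B` start out as the same set; the recursion consumes `C` along with the rows of `A`,
-- while each row is compared with all of `B`.
spread-set : ∀ {m n} → BitSet m → BitSet n → (Fin m → BitSet n) → BitSet m
spread-set C B A v = C v ∨ meets B (A v)

module _ (G : Graph) where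

  advance : Vertex G → BitSet (order G) → BitSet (order G)
  advance a B = updateAt (spread-set B B (adj G)) a (λ _ → true)

  finish : ∀ {k} → BitSet (order G) → Schedule G k → BitSet (order G)
  finish B []      = B
  finish B (a ∷ s) = finish (advance a B) s

  Succeeds : ∀ {k} → BitSet (order G) → Schedule G k → Set
  Succeeds B s = ∀ v → T (finish B s v)

  Solvable : ℕ → BitSet (order G) → Set
  Solvable k B = Σ[ s ∈ Schedule G k ] Succeeds B s

  -- The row of `v` lists edges out of `v`, whereas fire arrives along edges into `v`; `symm`
  -- exchanges the two.
  spread-set-⇔ : ∀ B v →
    T (spread-set B B (adj G) v) ⇔ (T (B v) ⊎ ∃[ u ] T (B u) × Adjacent G u v)
  spread-set-⇔ B v = mk⇔ forward backward
    where
    nbr? : Dec (∃[ u ] T (B u ∧ adj G v u))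
    nbr? = any? (λ u → T? (B u ∧ adj G v u))

    forward : T (spread-set B B (adj G) v) →
              T (B v) ⊎ ∃[ u ] T (B u) × Adjacent G u v
    forward t with to (T-∨ {B v}) t
    ... | inj₁ b = inj₁ b
    ... | inj₂ w with to (T-does nbr?) w
    ...   | u , ba = let b , a = to (T-∧ {B u}) ba in
                     inj₂ (u , b , trans (symm G u v) (to T-≡ a))

    backward : T (B v) ⊎ (∃[ u ] T (B u) × Adjacent G u v) →
               T (spread-set B B (adj G) v)
    backward (inj₁ b) = from T-∨ (inj₁ b)
    backward (inj₂ (u , b , a)) = from (T-∨ {B v}) (inj₂
      (from (T-does nbr?) (u , from T-∧ (b , from T-≡ (trans (symm G v u) a)))))

  advance-⇔ : ∀ a B v →
    T (advance a B v) ⇔ (v ≡ a ⊎ T (B v) ⊎ ∃[ u ] T (B u) × Adjacent G u v)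
  advance-⇔ a B v with v Fin.≟ a
  ... | yes refl = mk⇔ (λ _ → inj₁ refl)
    (λ _ → from T-≡ (updateAt-updates v (spread-set B B (adj G))))
  ... | no v≢a = mk⇔
    (λ t → inj₂ (to (spread-set-⇔ B v) (subst T unchanged t)))
    [ (λ v≡a → contradiction v≡a v≢a)
    , (λ r → subst T (sym unchanged) (from (spread-set-⇔ B v) r)) ]
    where
    unchanged : advance a B v ≡ spread-set B B (adj G) v
    unchanged = updateAt-minimal v a (spread-set B B (adj G)) v≢a

  -- B is the set of vertices burned by the end of round i.
  Describes : ∀ {m} → Schedule G m → ℕ → BitSet (order G) → Set
  Describes s i B = ∀ v → T (B v) ⇔ Burned G s i v

  advance-describes : ∀ {m} {s : Schedule G m} {B} (l : Fin m) →
    Describes s (toℕ l) B → Describes s (suc (toℕ l)) (advance (lookup s l) B)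
  advance-describes {m} {s} {B} l D v = mk⇔
    (λ t → grow (to (advance-⇔ (lookup s l) B v) t))
    (λ b → from (advance-⇔ (lookup s l) B v) (shrink b refl))
    where
    grow : v ≡ lookup s l ⊎ T (B v) ⊎ (∃[ u ] T (B u) × Adjacent G u v) →
           Burned G s (suc (toℕ l)) v
    grow (inj₁ refl)                 = activate l
    grow (inj₂ (inj₁ b))             = stay (to (D v) b)
    grow (inj₂ (inj₂ (u , b , a)))   = spread a (to (D u) b)

    -- The round is a variable with an equation, so that the derivation can be matched on; an
    -- activation in this round must then be the one at index `l`.
    shrink : ∀ {i v} → Burned G s i v → i ≡ suc (toℕ l) →
             v ≡ lookup s l ⊎ T (B v) ⊎ ∃[ u ] T (B u) × Adjacent G u v
    shrink (activate j) eq = inj₁ (cong (lookup s) (toℕ-injective (suc-injective eq)))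
    shrink (spread {u = u} a b) refl = inj₂ (inj₂ (u , from (D u) b , a))
    shrink (stay {v = w} b) refl = inj₂ (inj₁ (from (D w) b))

  -- The hypothesis on `j` makes `s′` the part of `s` from index `i` on. Phrasing it through indices
  -- avoids splitting and casting vectors.
  finish-describes : ∀ {m k} (s : Schedule G m) (s′ : Schedule G k) i {B} →
    (∀ j → Σ[ l ∈ Fin m ] toℕ l ≡ i + toℕ j × lookup s l ≡ lookup s′ j) →
    Describes s i B → Describes s (i + k) (finish B s′)
  finish-describes s [] i suffix D =
    subst (λ r → Describes s r _) (sym (+-identityʳ i)) D
  finish-describes {k = suc k} s (a ∷ s′) i {B} suffix D
    with suffix zero
  ... | l , l≡i , refl with trans l≡i (+-identityʳ i)
  ...   | refl = subst (λ r → Describes s r (finish B (a ∷ s′))) (sym (+-suc i k))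
    (finish-describes s s′ (suc i)
      (λ j → let l′ , eq , same = suffix (suc j) in l′ , trans eq (+-suc i _) , same)
      (advance-describes l D))

  ∅ : BitSet (order G)
  ∅ _ = false

  burns-⇔ : ∀ {m} (s : Schedule G m) → Burns G s ⇔ Succeeds ∅ s
  burns-⇔ s = mk⇔ (λ b v → from (D v) (b v)) (λ t v → to (D v) (t v))
    where
    D : Describes s _ (finish ∅ s)
    D = finish-describes s s 0 (λ j → j , refl , refl) (λ v → mk⇔ (λ ()) (λ ()))

  -- Burning within the diameter

  stays : ∀ {m} {s : Schedule G m} {i v} j → Burned G s i v → Burned G s (j + i) v
  stays zero    b = b
  stays (suc j) b = stay (stays j b)

  burned-along : ∀ {m} {s : Schedule G m} {i u v k} →
    Walk G u v k → Burned G s i u → Burned G s (k + i) v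
  burned-along stop b = b
  burned-along {s = s} {i} (step {w = w} {k} a p) b =
    subst (λ r → Burned G s r w) (+-suc k i) (burned-along p (spread a b))

  within-diameter : ∀ c → DiameterAtMost c G →
    Σ[ s ∈ Schedule G (suc c) ] Burns G s
  within-diameter c (D , (near , u , _) , D≤c) = s , burns
    where
    s : Schedule G (suc c)
    -- A vertex at distance `d` from `u` burns by round `d + 1`, since `u` burns in round 1; `stays`
    -- covers the other `c ∸ d` rounds.
    s = Vec.replicate (suc c) u

    burns : Burns G s
    burns v with near u v
    ... | d , (w , _) , d≤D = subst (λ r → Burned G s r v)
      (trans (cong (c ∸ d +_) (+-comm d 1))
        (trans (+-suc (c ∸ d) d) (cong suc (m∸n+n≡m (≤-trans d≤D D≤c)))))
      (stays (c ∸ d) (burned-along w (activate zero)))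

-- The program

searchᶠ firstᶠ allᶠ insertᶠ spreadᶠ meetsᶠ emptyᶠ : Fin 8
searchᶠ = # 1
firstᶠ  = # 2
allᶠ    = # 3
insertᶠ = # 4
spreadᶠ = # 5
meetsᶠ  = # 6
emptyᶠ  = # 7

trueᵉ : Exp 8
trueᵉ = cons nil nil

-- The argument is (k , B , G).  The result is nil if no k further activators
-- burn everything from B, and a pair of nil and such a schedule otherwise.
searchᵉ : Exp 8
searchᵉ = if hd arg
          then call firstᶠ (cons arg (cons nil (tl (tl arg))))
          else call allᶠ (tl arg)

-- The argument is ((1 + k , B , G) , a , R), where R lists the rows of G from a
-- onwards; the first activator ranges over the vertices from a onwards.
nextᵉ firstᵉ : Exp 8
nextᵉ =
  cons (tl (hd (hd arg)))
    (cons (call insertᶠ (cons (hd (tl arg))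
            (call spreadᶠ (cons (hd (tl (hd arg))) (tl (hd arg))))))
          (tl (tl (hd arg))))
firstᵉ = if tl (tl arg)
         then (if call searchᶠ nextᵉ
               -- With no local variables to hold the result, a successful search is repeated to
               -- extract its schedule.
               then cons nil (cons (hd (tl arg)) (tl (call searchᶠ nextᵉ)))
               else call firstᶠ (cons (hd arg)
                      (cons (cons nil (hd (tl arg))) (tl (tl (tl arg))))))
         else nil

allᵉ : Exp 8
allᵉ = if tl arg
       then (if hd (hd arg)
             then call allᶠ (cons (tl (hd arg)) (tl (tl arg)))
             else nil)
       else trueᵉ

insertᵉ : Exp 8
insertᵉ = if hd arg
          then cons (hd (tl arg))
                 (call insertᶠ (cons (tl (hd arg)) (tl (tl arg))))
          else cons trueᵉ (tl (tl arg))

spreadᵉ : Exp 8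
spreadᵉ = if tl (tl arg)
          then cons
            (if hd (hd arg)
             then trueᵉ
             else call meetsᶠ (cons (hd (tl arg)) (hd (tl (tl arg)))))
            (call spreadᶠ (cons (tl (hd arg))
              (cons (hd (tl arg)) (tl (tl (tl arg))))))
          else nil

meetsᵉ : Exp 8
meetsᵉ = if tl arg
         then (if (if hd (hd arg) then hd (tl arg) else nil)
               then trueᵉ
               else call meetsᶠ (cons (tl (hd arg)) (tl (tl arg))))
         else nil

-- Applied to the graph itself: each row yields one `nil`, the code of `false`, so the empty set
-- gets the right length.
emptyᵉ : Exp 8
emptyᵉ = if arg then cons nil (call emptyᶠ (tl arg)) else nil

quoteℕ : ℕ → Exp 8
quoteℕ zero    = nil
quoteℕ (suc n) = cons nil (quoteℕ n)

solveᵉ : ℕ → Exp 8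
solveᵉ m = call searchᶠ (cons (quoteℕ m) (cons (call emptyᶠ arg) arg))

-- The loop over the lengths `m`, `m + 1`, ... is unrolled into `j` nested conditionals, each with
-- its length as a literal.
attemptsᵉ : ℕ → ℕ → Exp 8
attemptsᵉ zero    m = nil
attemptsᵉ (suc j) m =
  if solveᵉ m then tl (solveᵉ m) else attemptsᵉ j (suc m)

-- None of the other functions calls `main`, so their evaluation is analysed once for every entry
-- point.
code : Exp 8 → Vec (Exp 8) 8
code main =
  main ∷ searchᵉ ∷ firstᵉ ∷ allᵉ ∷ insertᵉ ∷ spreadᵉ ∷ meetsᵉ ∷ emptyᵉ ∷ []

-- Encodings and cost functions

encodeSet : ∀ {n} → BitSet n → Tree
encodeSet B = encodeList encodeBool (List.tabulate B)

encodeRows : ∀ {m n} → (Fin m → BitSet n) → Tree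
encodeRows A = encodeList (encodeList encodeBool) (List.tabulate (List.tabulate ∘ A))

encodeState : ∀ G → ℕ → BitSet (order G) → Tree
encodeState G k B = encodeℕ k ∙ encodeSet B ∙ encodeGraph G

-- The leading `nil` separates success with the empty schedule, which is itself encoded as `nil`,
-- from failure.
answer : ∀ {G k} {P : Schedule G k → Set} → Dec (Σ[ s ∈ Schedule G k ] P s) → Tree
answer {G} (yes (s , _)) = nil ∙ encodeSchedule G s
answer     (no _)        = nil

-- The constants count the evaluation steps of the function bodies; a bound for
-- a conditional on a bit charges both branches.
meetsCost emptyCost insertCost allCost spreadCost nextCost : ℕ → ℕ
meetsCost  n = suc n * 23
emptyCost  n = suc n * 7
insertCost n = suc n * 15
allCost    n = suc n * 16
spreadCost n = suc n * (34 + meetsCost n)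
nextCost   n = 24 + (spreadCost n + insertCost n)

-- `S` bounds a search with one activator fewer, and `m` counts the remaining candidates. Each is
-- charged for two such searches: the test and the extraction of the schedule.
firstCost : ℕ → ℕ → ℕ → ℕ
firstCost S m n = suc m * (20 + (nextCost n + S + (nextCost n + S)))

searchCost : ℕ → ℕ → ℕ
searchCost zero    n = 6 + allCost n
searchCost (suc k) n = 11 + firstCost (searchCost k n) n n

solveCost : ℕ → ℕ → ℕ
solveCost m n = 3 + m * 2 + (3 + (emptyCost n + 1)) + searchCost m n

attemptsCost : ℕ → ℕ → ℕ → ℕ
attemptsCost zero    m n = 0
attemptsCost (suc j) m n =
  suc (solveCost m n + suc (solveCost m n + attemptsCost j (suc m) n))

-- Evaluation within time bounds

module _ {main : Exp 8} where

  infix 3 _⊢_⇓_within_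

  _⊢_⇓_within_ : Tree → Exp 8 → Tree → ℕ → Set
  x ⊢ e ⇓ v within T = ∃[ t ] Eval (code main) x e v t × t ≤ T

  relax : ∀ {x e v T T′} → x ⊢ e ⇓ v within T → T ≤ T′ → x ⊢ e ⇓ v within T′
  relax (t , d , t≤T) T≤T′ = t , d , ≤-trans t≤T T≤T′

  argᵗ : ∀ {x} → x ⊢ arg ⇓ x within 1
  argᵗ = 1 , arg , ≤-refl

  nilᵗ : ∀ {x} → x ⊢ nil ⇓ nil within 1
  nilᵗ = 1 , nil , ≤-refl

  consᵗ : ∀ {x e₁ e₂ v₁ v₂ T₁ T₂} →
    x ⊢ e₁ ⇓ v₁ within T₁ → x ⊢ e₂ ⇓ v₂ within T₂ →
    x ⊢ cons e₁ e₂ ⇓ v₁ ∙ v₂ within suc (T₁ + T₂)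
  consᵗ (_ , d₁ , b₁) (_ , d₂ , b₂) = _ , cons d₁ d₂ , s≤s (+-mono-≤ b₁ b₂)

  hdᵗ : ∀ {x e v T} → x ⊢ e ⇓ v within T → x ⊢ hd e ⇓ head v within suc T
  hdᵗ (_ , d , b) = _ , hd d , s≤s b

  tlᵗ : ∀ {x e v T} → x ⊢ e ⇓ v within T → x ⊢ tl e ⇓ tail v within suc T
  tlᵗ (_ , d , b) = _ , tl d , s≤s b

  if-thenᵗ : ∀ {x e₁ e₂ e₃ a b v T₁ T₂} →
    x ⊢ e₁ ⇓ a ∙ b within T₁ → x ⊢ e₂ ⇓ v within T₂ →
    x ⊢ if e₁ then e₂ else e₃ ⇓ v within suc (T₁ + T₂)
  if-thenᵗ (_ , d₁ , b₁) (_ , d₂ , b₂) = _ , if-then d₁ d₂ , s≤s (+-mono-≤ b₁ b₂)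

  if-elseᵗ : ∀ {x e₁ e₂ e₃ v T₁ T₂} →
    x ⊢ e₁ ⇓ nil within T₁ → x ⊢ e₃ ⇓ v within T₂ →
    x ⊢ if e₁ then e₂ else e₃ ⇓ v within suc (T₁ + T₂)
  if-elseᵗ (_ , d₁ , b₁) (_ , d₂ , b₂) = _ , if-else d₁ d₂ , s≤s (+-mono-≤ b₁ b₂)

  -- `V` acts as a motive: the result is an expression in the bit, so uses of the rule need no case
  -- split on it.
  ifᵗ : ∀ {x e₁ e₂ e₃ T₁ T₂ T₃} (V : Bool → Tree) b →
    x ⊢ e₁ ⇓ encodeBool b within T₁ →
    x ⊢ e₂ ⇓ V true within T₂ → x ⊢ e₃ ⇓ V false within T₃ →
    x ⊢ if e₁ then e₂ else e₃ ⇓ V b within suc (T₁ + (T₂ + T₃))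
  ifᵗ {T₁ = T₁} {T₂} {T₃} V true  d₁ d₂ d₃ =
    relax (if-thenᵗ d₁ d₂) (s≤s (+-monoʳ-≤ T₁ (m≤m+n T₂ T₃)))
  ifᵗ {T₁ = T₁} {T₂} {T₃} V false d₁ d₂ d₃ =
    relax (if-elseᵗ d₁ d₃) (s≤s (+-monoʳ-≤ T₁ (m≤n+m T₃ T₂)))

  callᵗ : ∀ {x f e y v T₁ T₂} →
    x ⊢ e ⇓ y within T₁ → y ⊢ lookup (code main) f ⇓ v within T₂ →
    x ⊢ call f e ⇓ v within suc (T₁ + T₂)
  callᵗ (_ , d₁ , b₁) (_ , d₂ , b₂) = _ , call d₁ d₂ , s≤s (+-mono-≤ b₁ b₂)

  trueᵗ : ∀ {x} → x ⊢ trueᵉ ⇓ encodeBool true within 3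
  trueᵗ = consᵗ nilᵗ nilᵗ

  -- Evaluation of the set operations

  meets-eval : ∀ {n} (B r : BitSet n) →
    encodeSet B ∙ encodeSet r ⊢ meetsᵉ ⇓ encodeBool (meets B r) within meetsCost n
  meets-eval {zero}  B r = relax (if-elseᵗ (tlᵗ argᵗ) nilᵗ) (m≤m+n 4 _)
  meets-eval {suc n} B r = if-thenᵗ (tlᵗ argᵗ)
    (ifᵗ (λ b → encodeBool (b ∨ meets (B ∘ suc) (r ∘ suc))) (B zero ∧ r zero)
      (ifᵗ (λ b → encodeBool (b ∧ r zero)) (B zero) (hdᵗ (hdᵗ argᵗ)) (hdᵗ (tlᵗ argᵗ)) nilᵗ)
      trueᵗ
      (callᵗ (consᵗ (tlᵗ (hdᵗ argᵗ)) (tlᵗ (tlᵗ argᵗ)))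
        (meets-eval (B ∘ suc) (r ∘ suc))))

  empty-eval : ∀ {m n} (A : Fin m → BitSet n) →
    encodeRows A ⊢ emptyᵉ ⇓ encodeSet {m} (λ _ → false) within emptyCost m
  empty-eval {zero}  A = relax (if-elseᵗ argᵗ nilᵗ) (m≤m+n 3 _)
  empty-eval {suc m} A =
    if-thenᵗ argᵗ (consᵗ nilᵗ (callᵗ (tlᵗ argᵗ) (empty-eval (A ∘ suc))))

  insert-eval : ∀ {n} a (B : BitSet n) →
    encodeℕ (toℕ a) ∙ encodeSet B ⊢ insertᵉ
      ⇓ encodeSet (updateAt B a (λ _ → true)) within insertCost n
  insert-eval {suc n} zero B =
    relax (if-elseᵗ (hdᵗ argᵗ) (consᵗ trueᵗ (tlᵗ (tlᵗ argᵗ)))) (m≤m+n 10 _)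
  insert-eval {suc n} (suc a) B = if-thenᵗ (hdᵗ argᵗ)
    (consᵗ (hdᵗ (tlᵗ argᵗ))
      (callᵗ (consᵗ (tlᵗ (hdᵗ argᵗ)) (tlᵗ (tlᵗ argᵗ))) (insert-eval a (B ∘ suc))))

  spread-eval : ∀ {m n} (C : BitSet m) (B : BitSet n) (A : Fin m → BitSet n) →
    encodeSet C ∙ encodeSet B ∙ encodeRows A ⊢ spreadᵉ
      ⇓ encodeSet (spread-set C B A) within suc m * (34 + meetsCost n)
  spread-eval {zero}  C B A = relax (if-elseᵗ (tlᵗ (tlᵗ argᵗ)) nilᵗ) (m≤m+n 5 _)
  spread-eval {suc m} {n} C B A = relax
    (if-thenᵗ (tlᵗ (tlᵗ argᵗ))
      (consᵗ
        (ifᵗ (λ b → encodeBool (b ∨ meets B (A zero))) (C zero)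
          (hdᵗ (hdᵗ argᵗ))
          trueᵗ
          (callᵗ (consᵗ (hdᵗ (tlᵗ argᵗ)) (hdᵗ (tlᵗ (tlᵗ argᵗ))))
            (meets-eval B (A zero))))
        (callᵗ (consᵗ (tlᵗ (hdᵗ argᵗ))
                 (consᵗ (hdᵗ (tlᵗ argᵗ)) (tlᵗ (tlᵗ (tlᵗ argᵗ)))))
          (spread-eval (C ∘ suc) B (A ∘ suc)))))
    (≤-reflexive (rearrange (meetsCost n) (suc m * (34 + meetsCost n))))
    where
    rearrange : ∀ M T → 21 + (M + (13 + T)) ≡ 34 + M + T
    rearrange = solve-∀

  -- The decision is built alongside the run, so that `does d` unfolds to the conjunction that
  -- `allᵉ` computes.
  all-eval : ∀ {m n} (B : BitSet m) (A : Fin m → BitSet n) →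
    Σ[ d ∈ Dec (∀ v → T (B v)) ]
      (encodeSet B ∙ encodeRows A ⊢ allᵉ ⇓ encodeBool (does d) within allCost m)
  all-eval {zero}  B A =
    yes (λ ()) , relax (if-elseᵗ (tlᵗ argᵗ) trueᵗ) (m≤m+n 6 _)
  all-eval {suc m} B A with all-eval (B ∘ suc) (A ∘ suc)
  ... | d , run =
    Dec.map′ (λ (b , bs) → ∀-cons b bs) (λ bs → bs zero , bs ∘ suc)
      (T? (B zero) Dec.×-dec d) ,
    relax
      (if-thenᵗ (tlᵗ argᵗ)
        (ifᵗ (λ b → encodeBool (b ∧ does d)) (B zero)
          (hdᵗ (hdᵗ argᵗ))
          (callᵗ (consᵗ (tlᵗ (hdᵗ argᵗ)) (tlᵗ (tlᵗ argᵗ))) run)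
          nilᵗ))
      (≤-reflexive (cong (15 +_) (+-comm (allCost m) 1)))

  -- Evaluation of the search

  next-eval : ∀ G k (B : BitSet (order G)) a {R} →
    encodeState G (suc k) B ∙ encodeℕ (toℕ a) ∙ R ⊢ nextᵉ
      ⇓ encodeState G k (advance G a B) within nextCost (order G)
  next-eval G k B a = relax
    (consᵗ (tlᵗ (hdᵗ (hdᵗ argᵗ)))
      (consᵗ
        (callᵗ (consᵗ (hdᵗ (tlᵗ argᵗ))
            (callᵗ (consᵗ (hdᵗ (tlᵗ (hdᵗ argᵗ))) (tlᵗ (hdᵗ argᵗ)))
              (spread-eval B B (adj G))))
          (insert-eval a (spread-set B B (adj G))))
        (tlᵗ (tlᵗ (hdᵗ argᵗ)))))
    (≤-reflexive (rearrange (spreadCost (order G)) (insertCost (order G))))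
    where
    rearrange : ∀ S I → 20 + (S + I + 4) ≡ 24 + (S + I)
    rearrange = solve-∀

  -- The search runs twice, as the condition and under `tl`; the allowance for later candidates
  -- covers the rest as slack.
  first-hit : ∀ {G k B a m n s S} {A : Fin (suc m) → BitSet n} →
    encodeState G k (advance G a B) ⊢ searchᵉ ⇓ nil ∙ s within S →
    encodeState G (suc k) B ∙ encodeℕ (toℕ a) ∙ encodeRows A ⊢ firstᵉ
      ⇓ nil ∙ encodeℕ (toℕ a) ∙ s within firstCost S (suc m) (order G)
  first-hit {G} {k} {B} {a} {m} {S = S} run = relax
    (if-thenᵗ (tlᵗ (tlᵗ argᵗ))
      (if-thenᵗ (callᵗ (next-eval G k B a) run)
        (consᵗ nilᵗ (consᵗ (hdᵗ (tlᵗ argᵗ)) (tlᵗ (callᵗ (next-eval G k B a) run))))))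
    (bound (nextCost (order G) + S) (firstCost S m (order G)))
    where
    rearrange : ∀ X F → 6 + (X + (8 + X)) + (6 + F) ≡ 20 + (X + X) + F
    rearrange = solve-∀

    bound : ∀ X F → 6 + (X + (8 + X)) ≤ 20 + (X + X) + F
    bound X F = ≤-trans (m≤m+n _ (6 + F)) (≤-reflexive (rearrange X F))

  -- A failed search runs once. Its second charge stays unspent, and the later candidates are paid
  -- for by the recursive bound.
  first-miss : ∀ {G k B a m n v S} {A : Fin (suc m) → BitSet n} →
    encodeState G k (advance G a B) ⊢ searchᵉ ⇓ nil within S →
    encodeState G (suc k) B ∙ encodeℕ (suc (toℕ a)) ∙ encodeRows (A ∘ suc) ⊢ firstᵉ
      ⇓ v within firstCost S m (order G) →
    encodeState G (suc k) B ∙ encodeℕ (toℕ a) ∙ encodeRows A ⊢ firstᵉ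
      ⇓ v within firstCost S (suc m) (order G)
  first-miss {G} {k} {B} {a} {m} {S = S} run run-rest = relax
    (if-thenᵗ (tlᵗ (tlᵗ argᵗ))
      (if-elseᵗ (callᵗ (next-eval G k B a) run)
        (callᵗ
          (consᵗ (hdᵗ argᵗ)
            (consᵗ (consᵗ nilᵗ (hdᵗ (tlᵗ argᵗ))) (tlᵗ (tlᵗ (tlᵗ argᵗ)))))
          run-rest)))
    (bound (nextCost (order G) + S) (firstCost S m (order G)))
    where
    rearrange : ∀ X F → 6 + (X + (14 + F)) + X ≡ 20 + (X + X) + F
    rearrange = solve-∀

    bound : ∀ X F → 6 + (X + (14 + F)) ≤ 20 + (X + X) + F
    bound X F = ≤-trans (m≤m+n _ X) (≤-reflexive (rearrange X F))

  -- The candidates for the first activator form a family `vs`, so that dropping one is `vs ∘ suc`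
  -- and their rows are `adj G ∘ vs`.
  StartsIn : ∀ {G k m} → (Fin m → Vertex G) → Schedule G (suc k) → Set
  StartsIn vs (a ∷ _) = ∃[ j ] a ≡ vs j

  mutual

    -- Correctness and running time are proved together: the decision follows the program, so its
    -- witness is the very schedule that is output. The recursion descends on `k`, and within
    -- `first-eval` also on the number of candidates.
    search-eval : ∀ G k B → Σ[ d ∈ Dec (Solvable G k B) ]
      (encodeState G k B ⊢ searchᵉ ⇓ answer {G} d within searchCost k (order G))
    search-eval G zero B with all-eval B (adj G)
    ... | yes t , run = yes ([] , t) , if-elseᵗ (hdᵗ argᵗ) (callᵗ (tlᵗ argᵗ) run)
    ... | no ¬t , run =
      no (λ { ([] , t) → ¬t t }) , if-elseᵗ (hdᵗ argᵗ) (callᵗ (tlᵗ argᵗ) run)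
    -- All vertices are candidates: for `vs = id` the encoded rows are definitionally
    -- `encodeGraph G`.
    search-eval G (suc k) B with first-eval G k B 0 id (λ _ → refl)
    ... | yes (s , _ , t) , run =
      yes (s , t) , if-thenᵗ (hdᵗ argᵗ)
        (callᵗ (consᵗ argᵗ (consᵗ nilᵗ (tlᵗ (tlᵗ argᵗ)))) run)
    ... | no ¬p , run =
      no (λ { (a ∷ s , t) → ¬p (a ∷ s , (a , refl) , t) }) , if-thenᵗ (hdᵗ argᵗ)
        (callᵗ (consᵗ argᵗ (consᵗ nilᵗ (tlᵗ (tlᵗ argᵗ)))) run)

    first-eval : ∀ G k B {m} i (vs : Fin m → Vertex G) →
      (∀ j → toℕ (vs j) ≡ i + toℕ j) →
      Σ[ d ∈ Dec (Σ[ s ∈ Schedule G (suc k) ] StartsIn {G} vs s × Succeeds G B s) ]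
        (encodeState G (suc k) B ∙ encodeℕ i ∙ encodeRows (adj G ∘ vs) ⊢ firstᵉ
          ⇓ answer {G} d within firstCost (searchCost k (order G)) m (order G))
    first-eval G k B {zero} i vs consecutive =
      no (λ { (_ ∷ _ , (() , _) , _) }) ,
      relax (if-elseᵗ (tlᵗ (tlᵗ argᵗ)) nilᵗ) (m≤m+n 5 _)
    first-eval G k B {suc m} i vs consecutive
      -- Matching on this equation turns the counter `i` into `toℕ (vs zero)`, the form needed by
      -- `first-hit` and `first-miss`.
      with trans (consecutive zero) (+-identityʳ i)
    ... | refl with search-eval G k (advance G (vs zero) B)
    ...   | yes (s , t) , run =
      yes (vs zero ∷ s , (zero , refl) , t) , first-hit {G} {B = B} {A = adj G ∘ vs} run
    ...   | no ¬p , run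
      with first-eval G k B (suc i) (vs ∘ suc)
             (λ j → trans (consecutive (suc j)) (+-suc i (toℕ j)))
    ...     | yes (a ∷ s , (j , eq) , t) , run-rest =
      yes (a ∷ s , (suc j , eq) , t) , first-miss {G} {B = B} {A = adj G ∘ vs} run run-rest
    ...     | no ¬q , run-rest =
      no (λ { (a ∷ s , (zero  , refl) , t) → ¬p (s , t)
            ; (a ∷ s , (suc j , eq)   , t) → ¬q (a ∷ s , (j , eq) , t) }) ,
      first-miss {G} {B = B} {A = adj G ∘ vs} run run-rest

  -- Trying all lengths

  quoteℕ-eval : ∀ {x} k → x ⊢ quoteℕ k ⇓ encodeℕ k within suc (k * 2)
  quoteℕ-eval zero    = nilᵗ
  quoteℕ-eval (suc k) = consᵗ nilᵗ (quoteℕ-eval k)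

  solve-eval : ∀ G m → Σ[ d ∈ Dec (Solvable G m (∅ G)) ]
    (encodeGraph G ⊢ solveᵉ m ⇓ answer {G} d within solveCost m (order G))
  solve-eval G m with search-eval G m (∅ G)
  ... | d , run = d , callᵗ
    (consᵗ (quoteℕ-eval m) (consᵗ (callᵗ argᵗ (empty-eval (adj G))) argᵗ)) run

  -- Invariant: no burning schedule is shorter than `m`, so a first success is optimal. As `j + m`
  -- stays `suc N`, running out of attempts would mean `m ≡ suc N`, against the given schedule of
  -- length `N`.
  attempts-eval : ∀ G N → Σ[ s ∈ Schedule G N ] Burns G s →
    ∀ j m → j + m ≡ suc N →
    (∀ {k} (s : Schedule G k) → Burns G s → m ≤ k) →
    Σ[ k ∈ ℕ ] Σ[ s ∈ Schedule G k ]
      ( IsBurningNumber G k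
      × Burns G s
      × (encodeGraph G ⊢ attemptsᵉ j m ⇓ encodeSchedule G s
          within attemptsCost j m (order G)) )
  attempts-eval G N (s , b) zero m refl least = contradiction (least s b) (n≮n N)
  attempts-eval G N burnable (suc j) m eq least with solve-eval G m
  ... | yes (s , t) , run =
    m , s , ((s , burns) , least) , burns ,
    relax (if-thenᵗ run (tlᵗ run)) (s≤s (+-monoʳ-≤ S (s≤s (m≤m+n S A))))
    where
    burns : Burns G s
    burns = from (burns-⇔ G s) t

    S A : ℕ
    S = solveCost m (order G)
    A = attemptsCost j (suc m) (order G)
  ... | no ¬p , run
    with attempts-eval G N burnable j (suc m) (trans (+-suc j m) eq)
           -- Failure at length `m` excludes burning schedules of that length and so raises the
           -- lower bound to `suc m`.
           (λ s b → ≤∧≢⇒< (least s b)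
              (λ { refl → ¬p (s , to (burns-⇔ G s) b) }))
  ...   | k , s , min , burns , run-rest =
    k , s , min , burns ,
    relax (if-elseᵗ run run-rest)
      (s≤s (+-monoʳ-≤ (solveCost m (order G))
        (m≤n+m _ (suc (solveCost m (order G))))))

-- Polynomiality of the costs and the theorem

meetsᵖ : IsPolynomial meetsCost
meetsᵖ = (constᵖ 1 +ᵖ idᵖ) *ᵖ constᵖ 23

spreadᵖ : IsPolynomial spreadCost
spreadᵖ = (constᵖ 1 +ᵖ idᵖ) *ᵖ (constᵖ 34 +ᵖ meetsᵖ)

nextᵖ : IsPolynomial nextCost
nextᵖ = constᵖ 24 +ᵖ (spreadᵖ +ᵖ (constᵖ 1 +ᵖ idᵖ) *ᵖ constᵖ 15)

-- Every further activator multiplies by a linear factor, so the degree grows with `k`; it stays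
-- fixed once `k` is bounded in terms of `c`.
searchᵖ : ∀ k → IsPolynomial (searchCost k)
searchᵖ zero    = constᵖ 6 +ᵖ (constᵖ 1 +ᵖ idᵖ) *ᵖ constᵖ 16
searchᵖ (suc k) = constᵖ 11 +ᵖ (constᵖ 1 +ᵖ idᵖ) *ᵖ
  (constᵖ 20 +ᵖ (nextᵖ +ᵖ searchᵖ k +ᵖ (nextᵖ +ᵖ searchᵖ k)))

solveᵖ : ∀ m → IsPolynomial (solveCost m)
solveᵖ m = constᵖ (suc (suc (suc (m * 2)))) +ᵖ
  (constᵖ 3 +ᵖ ((constᵖ 1 +ᵖ idᵖ) *ᵖ constᵖ 7 +ᵖ constᵖ 1)) +ᵖ searchᵖ m

attemptsᵖ : ∀ j m → IsPolynomial (attemptsCost j m)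
attemptsᵖ zero    m = constᵖ 0
attemptsᵖ (suc j) m =
  constᵖ 1 +ᵖ (solveᵖ m +ᵖ (constᵖ 1 +ᵖ (solveᵖ m +ᵖ attemptsᵖ j (suc m))))

length≤size : ∀ {A : Set} (enc : A → Tree) xs → List.length xs ≤ size (encodeList enc xs)
length≤size enc []       = z≤n
length≤size enc (x ∷ xs) = s≤s (≤-trans (length≤size enc xs) (m≤n+m _ (size (enc x))))

-- Costs are measured in the order, but the theorem in the input size; the encoding has one row per
-- vertex.
order≤size : ∀ G → order G ≤ size (encodeGraph G)
order≤size G =
  subst (_≤ size (encodeGraph G)) (length-tabulate rows) (length≤size _ (List.tabulate rows))
  where
  rows : Vertex G → List Bool
  rows u = List.tabulate (adj G u)

theorem2 : (c : ℕ) →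
    Σ[ P ∈ Program ] Σ[ p ∈ Polynomial ]
    ((G : Graph) → DiameterAtMost c G →
    Σ[ m ∈ ℕ ] Σ[ s ∈ Schedule G m ] Σ[ t ∈ ℕ ]
    ( IsBurningNumber G m
    × Burns G s
    × Runs P (encodeGraph G) (encodeSchedule G s) t
    × t ≤ evalPoly p (size (encodeGraph G)) ))
theorem2 c =
  -- There are `2 + c` attempts, for the lengths 0 to `1 + c`; `within-diameter` guarantees success
  -- by the last.
  record { bodies = code (attemptsᵉ (suc (suc c)) 0) } , proj₁ costᵖ , λ G diam →
  let m , s , min , burns , t , run , t≤cost =
        attempts-eval G (suc c) (within-diameter G c diam) (suc (suc c)) 0
          (+-identityʳ (suc (suc c))) (λ _ _ → z≤n)
  in m , s , t , min , burns , run ,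
     ≤-evalPoly costᵖ t≤cost (order≤size G)
  where
  costᵖ : IsPolynomial (attemptsCost (suc (suc c)) 0)
  costᵖ = attemptsᵖ (suc (suc c)) 0
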